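{- For all positive integers $k,n$, $$\sum_{i=1}^{n}M_{2i}^{(k)}=\frac{2^{2k}M_n^{(2k)}-n}{M_k} .$$
   Context: The Mersenne numbers $\{M_n\}_{n\ge 0}$ are defined by $M_0=0$, $M_1=1$, $M_{n+2}=3M_{n+1}-2M_n$, i.e. $M_n=2^n-1$. For a positive integer $k$, the higher order Mersenne numbers are $M_n^{(k)}=M_{kn}/M_k$ for $n=0,1,2,\dots$ (so $M_n^{(2k)}=M_{2kn}/M_{2k}$). -}

module Defs where

open import Data.Integer as ℤ using (ℤ; +_; 0ℤ; 1ℤ)
open import Data.Integer.Properties as ℤₚ using ()
open import Data.Integer.Tactic.RingSolver using (solve-∀)
open import Data.Nat as ℕ using (ℕ; zero; suc)
open import Data.Rational as ℚ using (ℚ; _÷_)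
open import Data.Rational.Properties using (pos⇒nonZero)
open import Data.Rational.Literals using (fromℤ)
open import Relation.Binary.PropositionalEquality

M : ℕ → ℤ
M 0             = 0ℤ
M 1             = 1ℤ
M (suc (suc n)) = + 3 ℤ.* M (suc n) ℤ.- + 2 ℤ.* M n

M-suc : ∀ n → M (suc n) ≡ + 2 ℤ.* M n ℤ.+ 1ℤ
M-suc zero    = refl
M-suc (suc n) = begin
  + 3 ℤ.* M (suc n) ℤ.- + 2 ℤ.* M n
    ≡⟨ lemma₁ (M (suc n)) (M n) ⟩
  + 2 ℤ.* M (suc n) ℤ.+ (M (suc n) ℤ.- + 2 ℤ.* M n)
    ≡⟨ cong (λ x → + 2 ℤ.* M (suc n) ℤ.+ (x ℤ.- + 2 ℤ.* M n)) (M-suc n) ⟩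
  + 2 ℤ.* M (suc n) ℤ.+ (+ 2 ℤ.* M n ℤ.+ 1ℤ ℤ.- + 2 ℤ.* M n)
    ≡⟨ cong (λ x → + 2 ℤ.* M (suc n) ℤ.+ x) (lemma₂ (M n)) ⟩
  + 2 ℤ.* M (suc n) ℤ.+ 1ℤ ∎
  where
  open ≡-Reasoning
  lemma₁ : ∀ x y → + 3 ℤ.* x ℤ.- + 2 ℤ.* y ≡ + 2 ℤ.* x ℤ.+ (x ℤ.- + 2 ℤ.* y)
  lemma₁ = solve-∀
  lemma₂ : ∀ y → + 2 ℤ.* y ℤ.+ 1ℤ ℤ.- + 2 ℤ.* y ≡ 1ℤ
  lemma₂ = solve-∀

M≡2^n-1 : ∀ n → M n ≡ + (2 ℕ.^ n) ℤ.- 1ℤ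
M≡2^n-1 zero    = refl
M≡2^n-1 (suc n) = begin
  M (suc n)                                 ≡⟨ M-suc n ⟩
  + 2 ℤ.* M n ℤ.+ 1ℤ                        ≡⟨ cong (λ x → + 2 ℤ.* x ℤ.+ 1ℤ) (M≡2^n-1 n) ⟩
  + 2 ℤ.* (+ (2 ℕ.^ n) ℤ.- 1ℤ) ℤ.+ 1ℤ       ≡⟨ lemma (+ (2 ℕ.^ n)) ⟩
  + 2 ℤ.* + (2 ℕ.^ n) ℤ.- 1ℤ                ≡⟨ cong (ℤ._- 1ℤ) (ℤₚ.pos-* 2 (2 ℕ.^ n)) ⟨
  + (2 ℕ.^ suc n) ℤ.- 1ℤ                    ∎
  where
  open ≡-Reasoning
  lemma : ∀ x → + 2 ℤ.* (x ℤ.- 1ℤ) ℤ.+ 1ℤ ≡ + 2 ℤ.* x ℤ.- 1ℤ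
  lemma = solve-∀

M-positive : ∀ n → ℤ.Positive (M (suc n))
M-positive zero    = _
M-positive (suc n) = subst ℤ.Positive (sym (M-suc (suc n))) (step (M (suc n)) (M-positive n))
  where
  step : ∀ x → ℤ.Positive x → ℤ.Positive (+ 2 ℤ.* x ℤ.+ 1ℤ)
  step ℤ.+[1+ _ ] _ = _

fromℕ : ℕ → ℚ
fromℕ n = fromℤ (+ n)

Mℚ : ℕ → ℚ
Mℚ n = fromℤ (M n)

Mℚ-nonZero : ∀ k .{{_ : ℕ.NonZero k}} → ℚ.NonZero (Mℚ k)
Mℚ-nonZero (suc k) = pos⇒nonZero (Mℚ (suc k)) {{M-positive k}}

-- M⟨ k ⟩ n is Mₙ⁽ᵏ⁾. The quotient is formed in ℚ, so the definition does not
-- presuppose that M k divides M (k * n).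
M⟨_⟩_ : (k n : ℕ) .{{_ : ℕ.NonZero k}} → ℚ
M⟨ k ⟩ n = (Mℚ (k ℕ.* n) ÷ Mℚ k) {{Mℚ-nonZero k}}

{-# OPTIONS --safe #-}

-- With B = M_{2k} and Q = 2^{2k} = B + 1, the recurrence M_{2k(n+1)} = Q M_{2kn} + B
-- shows that the right-hand side grows by M_{2k(n+1)} / M_k when n increases by one,
-- so the sum telescopes.
module Submission where

open import Defs
open import Data.Fin using (toℕ)
open import Data.Nat using (ℕ; suc; NonZero; _^_) renaming (_*_ to _*ℕ_)
open import Data.Nat.Properties using (m*n≢0)
open import Data.Rational using (_*_; _-_; _÷_)
open import Data.Rational.Properties using (+-0-commutativeMonoid)
open import Algebra.Properties.CommutativeMonoid.Sum +-0-commutativeMonoid using (sum-syntax)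
open import Relation.Binary.PropositionalEquality using (_≡_)

import Data.Integer as ℤ
import Data.Integer.Properties as ℤₚ
open import Data.Integer.Tactic.RingSolver using (solve-∀)
open import Data.Nat using (zero; _+_)
open import Data.Nat.Properties using (*-suc; *-zeroʳ; *-assoc; *-comm; ^-distribˡ-+-*)
import Data.Rational as ℚ
import Data.Rational.Properties as ℚₚ
open import Data.Rational using (ℚ; 0ℚ; 1ℚ; 1/_)
open import Data.Rational.Literals using (fromℤ)
open import Data.Rational.Solver using (module +-*-Solver)
open import Data.Rational.Unnormalised using (*≡*)
open import Data.Rational.Unnormalised.Properties using (≃-sym; ≃-trans)
open import Relation.Binary.PropositionalEquality
  using (refl; sym; trans; cong; cong₂; module ≡-Reasoning)

open ≡-Reasoning

-- Let G(j) be the claimed value for j terms, so G(0) = 0. The recurrence (`Mℚ-+`) and Q - 1 = B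
-- give M_{2k(j+1)} - M_{2kj} = B (M_{2kj} + 1). Hence M_k G(j) grows by Q (M_{2kj} + 1) - 1 = Q
-- M_{2kj} + B = M_{2k(j+1)} (`increment`), the numerator of the next summand, and `telescope`
-- concludes.

fromℤ-homo-+ : ∀ i j → fromℤ (i ℤ.+ j) ≡ fromℤ i ℚ.+ fromℤ j
fromℤ-homo-+ i j = ℚₚ.toℚᵘ-injective
  -- Unnormalised equality is cross-multiplication; with all denominators 1 it becomes an integer
  -- ring identity.
  (≃-trans (*≡* (lemma i j)) (≃-sym (ℚₚ.toℚᵘ-homo-+ (fromℤ i) (fromℤ j))))
  where
  lemma : ∀ i j → (i ℤ.+ j) ℤ.* ℤ.1ℤ ≡ (i ℤ.* ℤ.1ℤ ℤ.+ j ℤ.* ℤ.1ℤ) ℤ.* ℤ.1ℤ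
  lemma = solve-∀

fromℤ-homo-* : ∀ i j → fromℤ (i ℤ.* j) ≡ fromℤ i * fromℤ j
fromℤ-homo-* i j = ℚₚ.toℚᵘ-injective
  (≃-trans (*≡* refl) (≃-sym (ℚₚ.toℚᵘ-homo-* (fromℤ i) (fromℤ j))))

fromℕ-suc : ∀ n → fromℕ (suc n) ≡ fromℕ n ℚ.+ 1ℚ
fromℕ-suc n = trans (cong fromℤ (ℤₚ.+-comm ℤ.1ℤ (ℤ.+ n))) (fromℤ-homo-+ (ℤ.+ n) ℤ.1ℤ)

M-+ : ∀ m n → M (m + n) ≡ ℤ.+ (2 ^ m) ℤ.* M n ℤ.+ M m
M-+ m n = begin
  M (m + n)
    ≡⟨ M≡2^n-1 (m + n) ⟩
  ℤ.+ (2 ^ (m + n)) ℤ.- ℤ.1ℤ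
    ≡⟨ cong (λ x → ℤ.+ x ℤ.- ℤ.1ℤ) (^-distribˡ-+-* 2 m n) ⟩
  ℤ.+ (2 ^ m *ℕ 2 ^ n) ℤ.- ℤ.1ℤ
    ≡⟨ cong (ℤ._- ℤ.1ℤ) (ℤₚ.pos-* (2 ^ m) (2 ^ n)) ⟩
  ℤ.+ (2 ^ m) ℤ.* ℤ.+ (2 ^ n) ℤ.- ℤ.1ℤ
    ≡⟨ lemma (ℤ.+ (2 ^ m)) (ℤ.+ (2 ^ n)) ⟩
  ℤ.+ (2 ^ m) ℤ.* (ℤ.+ (2 ^ n) ℤ.- ℤ.1ℤ) ℤ.+ (ℤ.+ (2 ^ m) ℤ.- ℤ.1ℤ)
    ≡⟨ cong₂ (λ x y → ℤ.+ (2 ^ m) ℤ.* x ℤ.+ y) (M≡2^n-1 n) (M≡2^n-1 m) ⟨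
  ℤ.+ (2 ^ m) ℤ.* M n ℤ.+ M m ∎
  where
  lemma : ∀ x y → x ℤ.* y ℤ.- ℤ.1ℤ ≡ x ℤ.* (y ℤ.- ℤ.1ℤ) ℤ.+ (x ℤ.- ℤ.1ℤ)
  lemma = solve-∀

Mℚ-+ : ∀ m n → Mℚ (m + n) ≡ fromℕ (2 ^ m) * Mℚ n ℚ.+ Mℚ m
Mℚ-+ m n = begin
  Mℚ (m + n)
    ≡⟨ cong fromℤ (M-+ m n) ⟩
  fromℤ (ℤ.+ (2 ^ m) ℤ.* M n ℤ.+ M m)
    ≡⟨ fromℤ-homo-+ (ℤ.+ (2 ^ m) ℤ.* M n) (M m) ⟩
  fromℤ (ℤ.+ (2 ^ m) ℤ.* M n) ℚ.+ Mℚ m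
    ≡⟨ cong (ℚ._+ Mℚ m) (fromℤ-homo-* (ℤ.+ (2 ^ m)) (M n)) ⟩
  fromℕ (2 ^ m) * Mℚ n ℚ.+ Mℚ m ∎

2^n≡Mℚ+1 : ∀ n → fromℕ (2 ^ n) ≡ Mℚ n ℚ.+ 1ℚ
2^n≡Mℚ+1 n = begin
  fromℕ (2 ^ n)
    ≡⟨ cong fromℤ (lemma (ℤ.+ (2 ^ n))) ⟩
  fromℤ (ℤ.+ (2 ^ n) ℤ.- ℤ.1ℤ ℤ.+ ℤ.1ℤ)
    ≡⟨ cong (λ x → fromℤ (x ℤ.+ ℤ.1ℤ)) (M≡2^n-1 n) ⟨
  fromℤ (M n ℤ.+ ℤ.1ℤ)
    ≡⟨ fromℤ-homo-+ (M n) ℤ.1ℤ ⟩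
  Mℚ n ℚ.+ 1ℚ ∎
  where
  lemma : ∀ x → x ≡ x ℤ.- ℤ.1ℤ ℤ.+ ℤ.1ℤ
  lemma = solve-∀

-- The sum unfolds at its first term, so the induction shifts `f` and `g` by one and absorbs `f 0`
-- into `g 0`.
telescope : ∀ (f g : ℕ → ℚ) → (∀ n → g (suc n) ≡ g n ℚ.+ f n) →
            ∀ n → g 0 ℚ.+ ∑[ i < n ] f (toℕ i) ≡ g n
telescope f g step zero    = ℚₚ.+-identityʳ (g 0)
telescope f g step (suc n) = begin
  g 0 ℚ.+ (f 0 ℚ.+ rest)  ≡⟨ ℚₚ.+-assoc (g 0) (f 0) rest ⟨
  g 0 ℚ.+ f 0 ℚ.+ rest    ≡⟨ cong (ℚ._+ rest) (step 0) ⟨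
  g 1 ℚ.+ rest            ≡⟨ telescope (λ j → f (suc j)) (λ j → g (suc j)) (λ j → step (suc j)) n ⟩
  g (suc n)               ∎
  where
  rest = ∑[ i < n ] f (suc (toℕ i))

-- Read `b` = M_{2k}, `a` = M_{2kj}, `m` = j, with `r` and `s` the inverses of M_{2k} and M_k. The
-- inverses are free variables so that the ring solver applies; only `b * r ≡ 1ℚ` is needed about
-- them.
increment : ∀ {q a′ m′} (b r a m s : ℚ) →
            b * r ≡ 1ℚ → q ≡ b ℚ.+ 1ℚ → a′ ≡ q * a ℚ.+ b → m′ ≡ m ℚ.+ 1ℚ →
            (q * (a′ * r) - m′) * s ≡ (q * (a * r) - m) * s ℚ.+ a′ * s
increment b r a m s br≡1 refl refl refl = begin
  (q * ((q * a ℚ.+ b) * r) - (m ℚ.+ 1ℚ)) * s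
    -- Since `q - 1ℚ` is `b`, the increment of `a` is `b * (a + 1)`, which isolates the factor
    -- `b * r`.
    ≡⟨ solve 5 (λ b r a m s → let q = b :+ con 1ℚ in
         (q :* ((q :* a :+ b) :* r) :- (m :+ con 1ℚ)) :* s
           := (q :* (a :* r) :- m) :* s :+ (q :* (a :+ con 1ℚ) :* (b :* r) :- con 1ℚ) :* s)
         refl b r a m s ⟩
  (q * (a * r) - m) * s ℚ.+ (q * (a ℚ.+ 1ℚ) * (b * r) - 1ℚ) * s
    ≡⟨ cong (λ x → (q * (a * r) - m) * s ℚ.+ (q * (a ℚ.+ 1ℚ) * x - 1ℚ) * s) br≡1 ⟩
  (q * (a * r) - m) * s ℚ.+ (q * (a ℚ.+ 1ℚ) * 1ℚ - 1ℚ) * s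
    ≡⟨ cong ((q * (a * r) - m) * s ℚ.+_) (solve 3 (λ b a s → let q = b :+ con 1ℚ in
         (q :* (a :+ con 1ℚ) :* con 1ℚ :- con 1ℚ) :* s := (q :* a :+ b) :* s)
         refl b a s) ⟩
  (q * (a * r) - m) * s ℚ.+ (q * a ℚ.+ b) * s ∎
  where
  open +-*-Solver
  q = b ℚ.+ 1ℚ

theorem2p18 : ∀ (k n : ℕ) .{{_ : NonZero k}} .{{_ : NonZero n}} →
    ∑[ i < n ] (M⟨ k ⟩ (2 *ℕ suc (toℕ i)))
    ≡ ((fromℕ (2 ^ (2 *ℕ k)) * (M⟨ 2 *ℕ k ⟩ n) {{m*n≢0 2 k}} - fromℕ n) ÷ Mℚ k) {{Mℚ-nonZero k}}
theorem2p18 k n = begin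
  total         ≡⟨ ℚₚ.+-identityˡ total ⟨
  0ℚ ℚ.+ total  ≡⟨ cong (ℚ._+ total) g0≡0 ⟨
  g 0 ℚ.+ total ≡⟨ telescope f g step n ⟩
  g n           ∎
  where
  d = 2 *ℕ k

  instance
    Mk≢0 : ℚ.NonZero (Mℚ k)
    Mk≢0 = Mℚ-nonZero k

    Md≢0 : ℚ.NonZero (Mℚ d)
    Md≢0 = Mℚ-nonZero d {{m*n≢0 2 k}}

  -- `g` is the right-hand side extended to index 0; `f` is shifted because `Fin` counts from 0.
  f g : ℕ → ℚ
  f j = M⟨ k ⟩ (2 *ℕ suc j)
  g j = (fromℕ (2 ^ d) * (Mℚ (d *ℕ j) ÷ Mℚ d) - fromℕ j) ÷ Mℚ k

  total : ℚ
  total = ∑[ i < n ] f (toℕ i)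

  g0≡0 : g 0 ≡ 0ℚ
  g0≡0 = begin
    (fromℕ (2 ^ d) * (Mℚ (d *ℕ 0) ÷ Mℚ d) - 0ℚ) ÷ Mℚ k
      ≡⟨ cong (λ x → (fromℕ (2 ^ d) * (Mℚ x ÷ Mℚ d) - 0ℚ) ÷ Mℚ k) (*-zeroʳ d) ⟩
    (fromℕ (2 ^ d) * (0ℚ ÷ Mℚ d) - 0ℚ) ÷ Mℚ k
      ≡⟨ solve 3 (λ q r s → (q :* (con 0ℚ :* r) :- con 0ℚ) :* s := con 0ℚ)
           refl (fromℕ (2 ^ d)) (1/ Mℚ d) (1/ Mℚ k) ⟩
    0ℚ ∎
    where open +-*-Solver

  Mℚ-d*suc : ∀ j → Mℚ (d *ℕ suc j) ≡ fromℕ (2 ^ d) * Mℚ (d *ℕ j) ℚ.+ Mℚ d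
  Mℚ-d*suc j = trans (cong Mℚ (*-suc d j)) (Mℚ-+ d (d *ℕ j))

  -- This identifies the numerators of the order-2k and order-k terms.
  index : ∀ j → d *ℕ suc j ≡ k *ℕ (2 *ℕ suc j)
  index j = trans (cong (_*ℕ suc j) (*-comm 2 k)) (*-assoc k 2 (suc j))

  step : ∀ j → g (suc j) ≡ g j ℚ.+ f j
  step j = begin
    g (suc j)
      ≡⟨ increment (Mℚ d) (1/ Mℚ d) (Mℚ (d *ℕ j)) (fromℕ j) (1/ Mℚ k)
           (ℚₚ.*-inverseʳ (Mℚ d)) (2^n≡Mℚ+1 d) (Mℚ-d*suc j) (fromℕ-suc j) ⟩
    g j ℚ.+ Mℚ (d *ℕ suc j) ÷ Mℚ k
      ≡⟨ cong (λ x → g j ℚ.+ Mℚ x ÷ Mℚ k) (index j) ⟩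
    g j ℚ.+ f j ∎
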